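{- Let $D_n$ be the $n$-dimensional dual cube. Then for $n\geq 2$ and $1\leq r\leq n-1$, $c\kappa_{r+1}(D_n)=rn-\frac{r(r+1)}{2}+1$.
   Context: The $n$-dimensional dual cube $D_n$ has vertex set all binary strings $u_1u_2\cdots u_{2n-1}$ of length $2n-1$; two vertices $u,v$ are adjacent iff they differ in exactly one bit position $i$, and either $1\leq i\leq n-1$ and $u_{2n-1}=v_{2n-1}=0$, or $n\leq i\leq 2n-2$ and $u_{2n-1}=v_{2n-1}=1$, or $i=2n-1$. For a non-complete graph $G$, an $r$-component cut is a set of vertices whose deletion yields a graph with at least $r$ components, and the $r$-component connectivity $c\kappa_r(G)$ is the minimum size of an $r$-component cut of $G$. -}

module Defs where

open import Data.Nat using (ℕ; zero; suc; _+_; _*_; _∸_; _≤_; _<_; _/_)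
open import Data.Bool using (Bool; true; false)
open import Data.Fin using (Fin; toℕ)
open import Data.Vec using (Vec; lookup)
open import Data.List using (List; length)
open import Data.List.Membership.Propositional using (_∈_)
open import Data.List.Relation.Unary.Unique.Propositional using (Unique)
open import Data.Product using (Σ; _×_; ∃; _,_)
open import Data.Sum using (_⊎_)
open import Relation.Binary.PropositionalEquality using (_≡_; _≢_)
open import Relation.Nullary using (¬_)

-- Vertices of D_n: binary strings u_1 … u_{2n-1}; bit position p (1-based)
-- is stored at index p - 1 of the vector.
Vertex : ℕ → Set
Vertex n = Vec Bool (2 * n ∸ 1)

LastBit : (n : ℕ) → Vertex n → Bool → Set
LastBit n u b = ∀ (j : Fin (2 * n ∸ 1)) → toℕ j ≡ 2 * n ∸ 2 → lookup u j ≡ b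

DifferExactlyAt : (n : ℕ) → Vertex n → Vertex n → Fin (2 * n ∸ 1) → Set
DifferExactlyAt n u v i =
  (lookup u i ≢ lookup v i) × (∀ j → j ≢ i → lookup u j ≡ lookup v j)

-- Adjacency in the dual cube D_n (positions 1..2n-1 are indices 0..2n-2)
Adj : (n : ℕ) → Vertex n → Vertex n → Set
Adj n u v = Σ (Fin (2 * n ∸ 1)) λ i → DifferExactlyAt n u v i ×
  ( (suc (toℕ i) ≤ n ∸ 1 × LastBit n u false × LastBit n v false)
  ⊎ ((n ≤ suc (toℕ i) × suc (toℕ i) ≤ 2 * n ∸ 2) × LastBit n u true × LastBit n v true)
  ⊎ (suc (toℕ i) ≡ 2 * n ∸ 1) )

data Reach (n : ℕ) (S : List (Vertex n)) (u : Vertex n) : Vertex n → Set where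
  here : ¬ (u ∈ S) → Reach n S u u
  step : ∀ {w v} → Reach n S u w → Adj n w v → ¬ (v ∈ S) → Reach n S u v

AtLeastComponents : (n : ℕ) → List (Vertex n) → ℕ → Set
AtLeastComponents n S k = Σ (Fin k → Vertex n) λ rep →
  (∀ a → ¬ (rep a ∈ S)) × (∀ a b → a ≢ b → ¬ Reach n S (rep a) (rep b))

IsComponentCut : (n k : ℕ) → List (Vertex n) → Set
IsComponentCut n k S = Unique S × AtLeastComponents n S k

ComponentConnectivity : (n k c : ℕ) → Set
ComponentConnectivity n k c =
  (Σ (List (Vertex n)) λ S → IsComponentCut n k S × length S ≡ c)
  × (∀ S → IsComponentCut n k S → c ≤ length S)

{-# OPTIONS --safe #-}

-- Label every surviving vertex by its component.  Splitting a cube Q_m along a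
-- coordinate and inducting shows that k + 1 labels on Q_m cost at least F m k
-- deletions.  The dual cube consists of 2^M clusters Q_M (M = n - 1) in each of
-- two classes, every two clusters of different classes being joined by one edge.
-- If fewer than 2^M ≥ F n r vertices are deleted, both classes contain an intact cluster;
-- all intact clusters carry one main label, and then every cluster does.  Either
-- the other labels are spread over several clusters and the cube bounds add up to
-- F n r, or one cluster carries all of them, and the cross edges at the vertices
-- labelled otherwise than main cost r deletions on top of F M r.  Equality is
-- attained by isolating r neighbours of a vertex inside its cluster.
module Submission where

open import Defs
open import Algebra.Properties.CommutativeSemigroup using (interchange)
open import Data.Bool using (Bool; true; false; not)
import Data.Bool as Bool
open import Data.Bool.Properties using (not-¬; ¬-not; not-involutive)
open import Data.Empty using (⊥-elim)
open import Data.Fin using (Fin; zero; suc; toℕ; _↑ˡ_; _↑ʳ_; inject₁; inject≤; fromℕ)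
import Data.Fin as Fin
open import Data.Fin.Properties using (toℕ-injective; toℕ-↑ˡ; toℕ-↑ʳ; toℕ-inject₁; toℕ-inject≤; toℕ-fromℕ; toℕ<n; inject≤-injective; splitAt⁻¹-↑ˡ; splitAt⁻¹-↑ʳ)
open import Data.Fin.Relation.Unary.Top using (view; ‵fromℕ; ‵inject₁)
open import Data.Fin.Subset using (Subset; ∣_∣; ⁅_⁆; _∪_; _∩_; _─_; _⊆_; ⊥; ⊤) renaming (_∈_ to _∈ₛ_; _∉_ to _∉ₛ_; _-_ to _-ₛ_)
open import Data.Fin.Subset.Properties using (p⊆q⇒∣p∣≤∣q∣; x∈p∪q⁺; x∈p∪q⁻; x∈p∩q⁺; x∈p∩q⁻; x∈⁅x⁆; x∈⁅y⁆⇒x≡y; ∣⁅x⁆∣≡1; ∣⊥∣≡0; ∣⊤∣≡n; x∈p∧x∉q⇒x∈p─q; p─q⊆p; x∈p∧x≢y⇒x∈p-y; x∈p⇒∣p-x∣<∣p∣; nonempty?; ∉⊥; ∪-comm) renaming (_∈?_ to _∈ₛ?_)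
open import Data.List using (List; []; _∷_; length; map; tabulate) renaming (_++_ to _++ₗ_)
import Data.List.Membership.DecPropositional as DecMembership
open import Data.List.Membership.Propositional using (_∈_; _∉_)
open import Data.List.Membership.Propositional.Properties using (∈-map⁺; ∈-map⁻; ∈-++⁺ˡ; ∈-++⁺ʳ; ∈-++⁻; ∈-tabulate⁺; ∈-tabulate⁻)
open import Data.List.Properties using (length-map; length-++; length-tabulate)
open import Data.List.Relation.Binary.Disjoint.Propositional using (Disjoint)
open import Data.List.Relation.Unary.All.Properties using (¬Any⇒All¬)
open import Data.List.Relation.Unary.AllPairs using ([]; _∷_)
open import Data.List.Relation.Unary.Any using (here; there)
open import Data.List.Relation.Unary.Unique.Propositional using (Unique)
open import Data.List.Relation.Unary.Unique.Propositional.Properties using (map⁺; ++⁺; tabulate⁺)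
open import Data.Maybe using (Maybe; just; nothing)
open import Data.Nat using (ℕ; zero; suc; pred; _+_; _*_; _∸_; _^_; _≤_; _<_; _/_; z≤n; s≤s; _≤?_)
open import Data.Nat.DivMod using (m*n/n≡m)
open import Data.Nat.Properties
open import Data.Nat.Tactic.RingSolver using (solve-∀)
open import Data.Product using (_×_; ∃; _,_; proj₁; proj₂)
open import Data.Sum using (_⊎_; inj₁; inj₂; [_,_]′)
import Data.Sum as Sum
open import Data.Vec using (Vec; []; _∷_; _[_]%=_; _++_; _∷ʳ_; head; splitAt; initLast; lookup; replicate; there)
open import Data.Vec.Properties using (lookup∘updateAt; lookup∘updateAt′; ≡-dec; tabulate∘lookup; tabulate-cong; ++-injective; ∷ʳ-injective)
open import Function using (_∘_)
open import Relation.Binary.PropositionalEquality using (_≡_; _≢_; refl; sym; trans; cong; cong₂; subst; subst₂; module ≡-Reasoning)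
open import Relation.Nullary using (¬_; yes; no; contradiction; Dec)
open import Relation.Nullary.Decidable using (decidable-stable; ¬¬-excluded-middle)

-- Arithmetic of the cost functions `G` and `F`.

private variable
  m n N A B : ℕ

-- G m k is (m - 1) + (m - 2) + ⋯ + (m - k), with truncated subtraction.
G : ℕ → ℕ → ℕ
G m       zero    = 0
G zero    (suc k) = 0
G (suc m) (suc k) = m + G m k

-- For 1 ≤ r ≤ m this is the (r + 1)-component connectivity of the cube Q_m;
-- F m 0 = 0 because a single label forces no deletion.
F : ℕ → ℕ → ℕ
F m zero    = 0
F m (suc k) = suc (G m (suc k))

G-zeroˡ : ∀ k → G 0 k ≡ 0
G-zeroˡ zero    = refl
G-zeroˡ (suc k) = refl

G-monoʳ : ∀ m {j k} → j ≤ k → G m j ≤ G m k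
G-monoʳ m       z≤n     = z≤n
G-monoʳ zero    (s≤s p) = z≤n
G-monoʳ (suc m) (s≤s p) = +-monoʳ-≤ m (G-monoʳ m p)

G-≤-suc : ∀ m k → G m k ≤ G (suc m) k
G-≤-suc m       zero    = z≤n
G-≤-suc zero    (suc k) = z≤n
G-≤-suc (suc m) (suc k) = +-mono-≤ (n≤1+n m) (G-≤-suc m k)

-- Raising m by one raises each of the k truncated summands by at most one.
G-suc-≤ : ∀ m k → G (suc m) k ≤ G m k + k
G-suc-≤ m       zero    = z≤n
G-suc-≤ zero    (suc k) = ≤-trans (≤-reflexive (G-zeroˡ k)) z≤n
G-suc-≤ (suc m) (suc k) = begin
  suc m + G (suc m) k   ≤⟨ +-monoʳ-≤ (suc m) (G-suc-≤ m k) ⟩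
  suc m + (G m k + k)   ≡⟨ shuffle m (G m k) k ⟩
  (m + G m k) + suc k   ∎
  where
  open ≤-Reasoning
  shuffle : ∀ m g k → suc m + (g + k) ≡ (m + g) + suc k
  shuffle = solve-∀

-- The summands decrease, so the last k of the j + k summands are at most the first k.
G-subadditive : ∀ m j k → G m (j + k) ≤ G m j + G m k
G-subadditive m       zero    k = ≤-refl
G-subadditive zero    (suc j) k = z≤n
G-subadditive (suc m) (suc j) k = begin
  m + G m (j + k)             ≤⟨ +-monoʳ-≤ m (G-subadditive m j k) ⟩
  m + (G m j + G m k)         ≤⟨ +-monoʳ-≤ m (+-monoʳ-≤ (G m j) (G-≤-suc m k)) ⟩
  m + (G m j + G (suc m) k)   ≡⟨ +-assoc m _ _ ⟨
  (m + G m j) + G (suc m) k   ∎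
  where open ≤-Reasoning

1+n≤2^n : ∀ n → suc n ≤ 2 ^ n
1+n≤2^n zero    = ≤-refl
1+n≤2^n (suc n) = begin
  suc (suc n)            ≤⟨ +-mono-≤ (s≤s (z≤n {n})) (1+n≤2^n n) ⟩
  suc n + 2 ^ n          ≤⟨ +-monoˡ-≤ (2 ^ n) (1+n≤2^n n) ⟩
  2 ^ n + 2 ^ n          ≡⟨ cong (2 ^ n +_) (+-identityʳ (2 ^ n)) ⟨
  2 ^ suc n              ∎
  where open ≤-Reasoning

-- Each increase of m adds at most `suc m` to the left side, and the doubling of the right side pays
-- for it because `suc m ≤ 2 ^ m`.
G<2^ : ∀ m k → G (suc m) k < 2 ^ m
G<2^ m       zero    = m^n>0 2 m
G<2^ zero    (suc k) = s≤s (≤-reflexive (G-zeroˡ k))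
G<2^ (suc m) (suc k) = begin
  suc (suc m + G (suc m) k)   ≡⟨ +-suc (suc m) _ ⟨
  suc m + suc (G (suc m) k)   ≤⟨ +-mono-≤ (1+n≤2^n m) (G<2^ m k) ⟩
  2 ^ m + 2 ^ m               ≡⟨ cong (2 ^ m +_) (+-identityʳ (2 ^ m)) ⟨
  2 ^ suc m                   ∎
  where open ≤-Reasoning

-- This disposes of every situation with at least `2 ^ m` deletions.
F≤2^ : ∀ m k → F (suc m) k ≤ 2 ^ m
F≤2^ m zero    = z≤n
F≤2^ m (suc k) = G<2^ m (suc k)

F-monoʳ : ∀ m {j k} → j ≤ k → F m j ≤ F m k
F-monoʳ m z≤n     = z≤n
F-monoʳ m (s≤s p) = s≤s (G-monoʳ m (s≤s p))

F-≤-suc : ∀ m k → F m k ≤ F (suc m) k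
F-≤-suc m zero    = z≤n
F-≤-suc m (suc k) = s≤s (G-≤-suc m (suc k))

F-suc-≤ : ∀ m k → F (suc m) k ≤ F m k + k
F-suc-≤ m zero    = z≤n
F-suc-≤ m (suc k) = s≤s (G-suc-≤ m (suc k))

-- For positive j and k both terms on the right carry the additive 1 of `F`. The second 1 makes up
-- for the leading summand on the left, which is larger by one, and subadditivity of `G` handles the
-- rest.
F-suc-+-≤ : ∀ m {j k} → 1 ≤ j → 1 ≤ k → F (suc m) (j + k) ≤ F m j + F m k
F-suc-+-≤ zero    {suc j} {suc k} p q = s≤s (≤-trans (≤-reflexive (G-zeroˡ (j + suc k))) z≤n)
F-suc-+-≤ (suc m) {suc j} {suc k} p q = begin
  suc (suc m + G (suc m) (j + suc k))        ≡⟨ cong (λ x → suc (suc m + G (suc m) x)) (+-suc j k) ⟩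
  suc (suc m + (m + G m (j + k)))            ≤⟨ s≤s (+-monoʳ-≤ (suc m) (+-monoʳ-≤ m (G-subadditive m j k))) ⟩
  suc (suc m + (m + (G m j + G m k)))        ≡⟨ shuffle m (G m j) (G m k) ⟩
  suc (m + G m j) + suc (m + G m k)          ∎
  where
  open ≤-Reasoning
  shuffle : ∀ m a b → suc (suc m + (m + (a + b))) ≡ suc (m + a) + suc (m + b)
  shuffle = solve-∀

F-subadditive : ∀ m j k → F m (j + k) ≤ F m j + F m k
F-subadditive m zero    k       = ≤-refl
F-subadditive m (suc j) zero    = ≤-trans (F-monoʳ m (≤-reflexive (+-identityʳ (suc j)))) (m≤m+n _ 0)
F-subadditive m (suc j) (suc k) = ≤-trans (F-≤-suc m (suc j + suc k)) (F-suc-+-≤ m (s≤s z≤n) (s≤s z≤n))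

-- For k ≤ m no summand is truncated, so each of the k summands grows by exactly one. This gives the
-- size of the extremal cut.
G-suc-exact : ∀ {m k} → k ≤ m → G (suc m) k ≡ G m k + k
G-suc-exact z≤n = refl
G-suc-exact {suc m} {suc k} (s≤s p) = trans (cong (suc m +_) (G-suc-exact p)) (shuffle m (G m k) k)
  where
  shuffle : ∀ m g k → suc m + (g + k) ≡ (m + g) + suc k
  shuffle = solve-∀

triangle : ℕ → ℕ
triangle zero    = 0
triangle (suc r) = suc r + triangle r

triangle-formula : ∀ r → r * (r + 1) / 2 ≡ triangle r
triangle-formula r = trans (cong (_/ 2) (sym (doubled r))) (m*n/n≡m (triangle r) 2)
  where
  doubled : ∀ r → triangle r * 2 ≡ r * (r + 1)
  doubled zero    = refl
  doubled (suc r) = trans (*-distribʳ-+ 2 (suc r) (triangle r)) (trans (cong (suc r * 2 +_) (doubled r)) (expand r))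
    where
    expand : ∀ r → suc r * 2 + r * (r + 1) ≡ suc r * (suc r + 1)
    expand = solve-∀

-- Pairing the summand n - i of `G` with i yields r copies of n. The additive form avoids truncated
-- subtraction.
G-+-triangle : ∀ {n r} → r ≤ n → G n r + triangle r ≡ r * n
G-+-triangle z≤n = refl
G-+-triangle {suc n} {suc r} (s≤s p) = begin
  (n + G n r) + (suc r + triangle r)   ≡⟨ shuffle n (G n r) r (triangle r) ⟩
  suc n + (r + (G n r + triangle r))   ≡⟨ cong (λ x → suc n + (r + x)) (G-+-triangle p) ⟩
  suc n + (r + r * n)                  ≡⟨ cong (suc n +_) (*-suc r n) ⟨
  suc r * suc n                        ∎
  where
  open ≡-Reasoning
  shuffle : ∀ n g r t → (n + g) + (suc r + t) ≡ suc n + (r + (g + t))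
  shuffle = solve-∀

closed-form : ∀ {n r} → r ≤ n → r * n ∸ (r * (r + 1)) / 2 + 1 ≡ suc (G n r)
closed-form {n} {r} p = begin
  r * n ∸ (r * (r + 1)) / 2 + 1               ≡⟨ cong (λ t → r * n ∸ t + 1) (triangle-formula r) ⟩
  r * n ∸ triangle r + 1                      ≡⟨ cong (λ s → s ∸ triangle r + 1) (G-+-triangle p) ⟨
  G n r + triangle r ∸ triangle r + 1         ≡⟨ cong (_+ 1) (m+n∸n≡m (G n r) (triangle r)) ⟩
  G n r + 1                                   ≡⟨ +-comm (G n r) 1 ⟩
  suc (G n r)                                 ∎
  where open ≡-Reasoning

-- Sums and unions over the vertices of a cube, and sizes of finite subsets.

sumᵥ : (Vec Bool m → ℕ) → ℕ
sumᵥ {zero}  f = f []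
sumᵥ {suc m} f = sumᵥ (f ∘ (false ∷_)) + sumᵥ (f ∘ (true ∷_))

sumᵥ-mono : {f g : Vec Bool m → ℕ} → (∀ v → f v ≤ g v) → sumᵥ f ≤ sumᵥ g
sumᵥ-mono {zero}  h = h []
sumᵥ-mono {suc m} h = +-mono-≤ (sumᵥ-mono (h ∘ (false ∷_))) (sumᵥ-mono (h ∘ (true ∷_)))

sumᵥ-cong : {f g : Vec Bool m → ℕ} → (∀ v → f v ≡ g v) → sumᵥ f ≡ sumᵥ g
sumᵥ-cong {zero}  h = h []
sumᵥ-cong {suc m} h = cong₂ _+_ (sumᵥ-cong (h ∘ (false ∷_))) (sumᵥ-cong (h ∘ (true ∷_)))

sumᵥ-+ : (f g : Vec Bool m → ℕ) → sumᵥ (λ v → f v + g v) ≡ sumᵥ f + sumᵥ g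
sumᵥ-+ {zero}  f g = refl
sumᵥ-+ {suc m} f g = trans
  (cong₂ _+_ (sumᵥ-+ (f ∘ (false ∷_)) (g ∘ (false ∷_))) (sumᵥ-+ (f ∘ (true ∷_)) (g ∘ (true ∷_))))
  (interchange +-commutativeSemigroup (sumᵥ (f ∘ (false ∷_))) _ _ _)

sumᵥ-≥1 : {f : Vec Bool m → ℕ} → (∀ v → 1 ≤ f v) → 2 ^ m ≤ sumᵥ f
sumᵥ-≥1 {zero}  h = h []
sumᵥ-≥1 {suc m} h = +-mono-≤ (sumᵥ-≥1 (h ∘ (false ∷_)))
  (≤-trans (≤-reflexive (+-identityʳ (2 ^ m))) (sumᵥ-≥1 (h ∘ (true ∷_))))

sumᵥ-swap : (f : Vec Bool m → Vec Bool n → ℕ) →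
  sumᵥ (λ u → sumᵥ (f u)) ≡ sumᵥ (λ v → sumᵥ (λ u → f u v))
sumᵥ-swap {zero}  f = refl
sumᵥ-swap {suc m} f = trans
  (cong₂ _+_ (sumᵥ-swap (f ∘ (false ∷_))) (sumᵥ-swap (f ∘ (true ∷_))))
  (sym (sumᵥ-+ (λ v → sumᵥ (λ u → f (false ∷ u) v)) _))

≤-sumᵥ : (f : Vec Bool m → ℕ) → ∀ v → f v ≤ sumᵥ f
≤-sumᵥ f []          = ≤-refl
≤-sumᵥ f (false ∷ v) = ≤-trans (≤-sumᵥ (f ∘ (false ∷_)) v) (m≤m+n _ _)
≤-sumᵥ f (true ∷ v)  = ≤-trans (≤-sumᵥ (f ∘ (true ∷_)) v) (m≤n+m _ _)

-- Pigeonhole by descent: if both halves reached `2 ^ m`, the sum would reach `2 ^ suc m`.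
sumᵥ-small⇒zero : (f : Vec Bool m → ℕ) → sumᵥ f < 2 ^ m → ∃ λ v → f v ≡ 0
sumᵥ-small⇒zero {zero}  f h = [] , n<1⇒n≡0 h
sumᵥ-small⇒zero {suc m} f h with <-≤-connex (sumᵥ (f ∘ (false ∷_))) (2 ^ m)
... | inj₁ l = let v , e = sumᵥ-small⇒zero (f ∘ (false ∷_)) l in false ∷ v , e
... | inj₂ g with <-≤-connex (sumᵥ (f ∘ (true ∷_))) (2 ^ m)
...   | inj₁ l = let v , e = sumᵥ-small⇒zero (f ∘ (true ∷_)) l in true ∷ v , e
...   | inj₂ g′ = contradiction
    (+-mono-≤ g (≤-trans (≤-reflexive (+-identityʳ (2 ^ m))) g′)) (<⇒≱ h)

unionᵥ : (Vec Bool m → Subset N) → Subset N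
unionᵥ {zero}  f = f []
unionᵥ {suc m} f = unionᵥ (f ∘ (false ∷_)) ∪ unionᵥ (f ∘ (true ∷_))

∈-unionᵥ⁺ : (f : Vec Bool m → Subset N) → ∀ v {i} → i ∈ₛ f v → i ∈ₛ unionᵥ f
∈-unionᵥ⁺ f []          h = h
∈-unionᵥ⁺ f (false ∷ v) h = x∈p∪q⁺ (inj₁ (∈-unionᵥ⁺ (f ∘ (false ∷_)) v h))
∈-unionᵥ⁺ f (true ∷ v)  h = x∈p∪q⁺ (inj₂ (∈-unionᵥ⁺ (f ∘ (true ∷_)) v h))

∈-unionᵥ⁻ : (f : Vec Bool m → Subset N) → ∀ {i} → i ∈ₛ unionᵥ f → ∃ λ v → i ∈ₛ f v
∈-unionᵥ⁻ {zero}  f h = [] , h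
∈-unionᵥ⁻ {suc m} f h with x∈p∪q⁻ (unionᵥ (f ∘ (false ∷_))) _ h
... | inj₁ h′ = let v , q = ∈-unionᵥ⁻ (f ∘ (false ∷_)) h′ in false ∷ v , q
... | inj₂ h′ = let v , q = ∈-unionᵥ⁻ (f ∘ (true ∷_)) h′ in true ∷ v , q

∣p∪q∣≤∣p∣+∣q∣ : (p q : Subset N) → ∣ p ∪ q ∣ ≤ ∣ p ∣ + ∣ q ∣
∣p∪q∣≤∣p∣+∣q∣ []          []          = z≤n
∣p∪q∣≤∣p∣+∣q∣ (true ∷ p)  (true ∷ q)  = s≤s (≤-trans (∣p∪q∣≤∣p∣+∣q∣ p q) (+-monoʳ-≤ ∣ p ∣ (n≤1+n ∣ q ∣)))
∣p∪q∣≤∣p∣+∣q∣ (true ∷ p)  (false ∷ q) = s≤s (∣p∪q∣≤∣p∣+∣q∣ p q)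
∣p∪q∣≤∣p∣+∣q∣ (false ∷ p) (true ∷ q)  = ≤-trans (s≤s (∣p∪q∣≤∣p∣+∣q∣ p q)) (≤-reflexive (sym (+-suc ∣ p ∣ ∣ q ∣)))
∣p∪q∣≤∣p∣+∣q∣ (false ∷ p) (false ∷ q) = ∣p∪q∣≤∣p∣+∣q∣ p q

x∈p─q⇒x∉q : (p q : Subset N) {x : Fin N} → x ∈ₛ p ─ q → x ∉ₛ q
x∈p─q⇒x∉q (_ ∷ p) (true ∷ q)  (there h) (there h′) = x∈p─q⇒x∉q p q h h′
x∈p─q⇒x∉q (_ ∷ p) (false ∷ q) (there h) (there h′) = x∈p─q⇒x∉q p q h h′

∣p∣≤∣p─q∣+∣q∣ : (p q : Subset N) → ∣ p ∣ ≤ ∣ p ─ q ∣ + ∣ q ∣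
∣p∣≤∣p─q∣+∣q∣ p q = ≤-trans (p⊆q⇒∣p∣≤∣q∣ cover) (∣p∪q∣≤∣p∣+∣q∣ (p ─ q) q)
  where
  cover : p ⊆ (p ─ q) ∪ q
  cover {x} x∈p with x ∈ₛ? q
  ... | yes x∈q = x∈p∪q⁺ (inj₂ x∈q)
  ... | no  x∉q = x∈p∪q⁺ (inj₁ (x∈p∧x∉q⇒x∈p─q x∈p x∉q))

x∈p⇒1≤∣p∣ : {p : Subset N} {x : Fin N} → x ∈ₛ p → 1 ≤ ∣ p ∣
x∈p⇒1≤∣p∣ x∈p = ≤-trans (s≤s z≤n) (x∈p⇒∣p-x∣<∣p∣ x∈p)

∣p∣≤1⇒x≡y : {p : Subset N} {x y : Fin N} → ∣ p ∣ ≤ 1 → x ∈ₛ p → y ∈ₛ p → x ≡ y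
∣p∣≤1⇒x≡y {x = x} {y} h x∈p y∈p with x Fin.≟ y
... | yes e = e
... | no ne = contradiction
  (≤-trans (s≤s (x∈p⇒1≤∣p∣ (x∈p∧x≢y⇒x∈p-y y∈p (ne ∘ sym)))) (x∈p⇒∣p-x∣<∣p∣ x∈p)) (<⇒≱ (s≤s h))

∣p∪q∣<∣p∣+∣q∣ : (p q : Subset N) {x : Fin N} → x ∈ₛ p → x ∈ₛ q → ∣ p ∪ q ∣ < ∣ p ∣ + ∣ q ∣
∣p∪q∣<∣p∣+∣q∣ p q {x} x∈p x∈q = begin-strict
  ∣ p ∪ q ∣              ≤⟨ p⊆q⇒∣p∣≤∣q∣ cover ⟩
  ∣ p ∪ (q -ₛ x) ∣       ≤⟨ ∣p∪q∣≤∣p∣+∣q∣ p (q -ₛ x) ⟩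
  ∣ p ∣ + ∣ q -ₛ x ∣     <⟨ +-monoʳ-< ∣ p ∣ (x∈p⇒∣p-x∣<∣p∣ x∈q) ⟩
  ∣ p ∣ + ∣ q ∣          ∎
  where
  open ≤-Reasoning
  cover : p ∪ q ⊆ p ∪ (q -ₛ x)
  cover {y} h with x∈p∪q⁻ p q h | y Fin.≟ x
  ... | inj₁ y∈p | _        = x∈p∪q⁺ (inj₁ y∈p)
  ... | inj₂ y∈q | yes refl = x∈p∪q⁺ (inj₁ x∈p)
  ... | inj₂ y∈q | no y≢x   = x∈p∪q⁺ (inj₂ (x∈p∧x≢y⇒x∈p-y y∈q y≢x))

∣unionᵥ∣≤sumᵥ : (f : Vec Bool m → Subset N) → ∣ unionᵥ f ∣ ≤ sumᵥ (∣_∣ ∘ f)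
∣unionᵥ∣≤sumᵥ {zero}  f = ≤-refl
∣unionᵥ∣≤sumᵥ {suc m} f = ≤-trans (∣p∪q∣≤∣p∣+∣q∣ (unionᵥ (f ∘ (false ∷_))) _)
  (+-mono-≤ (∣unionᵥ∣≤sumᵥ (f ∘ (false ∷_))) (∣unionᵥ∣≤sumᵥ (f ∘ (true ∷_))))

-- Labelled cubes and their deletion bound.

-- A label is the component of a vertex; deleted vertices carry nothing.
Label : ℕ → Set
Label N = Maybe (Fin N)

Compatible : Label N → Label N → Set
Compatible x y = ∀ {i j} → x ≡ just i → y ≡ just j → i ≡ j

Compatible-sym : {x y : Label N} → Compatible x y → Compatible y x
Compatible-sym c p q = sym (c q p)

deleted : Label N → ℕ
deleted nothing  = 1
deleted (just _) = 0

labelSet : Label N → Subset N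
labelSet nothing  = ⊥
labelSet (just i) = ⁅ i ⁆

∈-labelSet⁻ : (x : Label N) {i : Fin N} → i ∈ₛ labelSet x → x ≡ just i
∈-labelSet⁻ nothing  h = ⊥-elim (∉⊥ h)
∈-labelSet⁻ (just j) h = cong just (sym (x∈⁅y⁆⇒x≡y j h))

∈-labelSet⁺ : {x : Label N} {i : Fin N} → x ≡ just i → i ∈ₛ labelSet x
∈-labelSet⁺ refl = x∈⁅x⁆ _

∣labelSet∣≤1 : (x : Label N) → ∣ labelSet x ∣ ≤ 1
∣labelSet∣≤1 {N} nothing = ≤-trans (≤-reflexive (∣⊥∣≡0 N)) z≤n
∣labelSet∣≤1 (just i) = ≤-reflexive (∣⁅x⁆∣≡1 i)

faults : (Vec Bool m → Label N) → ℕ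
faults L = sumᵥ (deleted ∘ L)

used : (Vec Bool m → Label N) → Subset N
used L = unionᵥ (labelSet ∘ L)

∈-used⁺ : (L : Vec Bool m → Label N) → ∀ {v i} → L v ≡ just i → i ∈ₛ used L
∈-used⁺ L {v} e = ∈-unionᵥ⁺ (labelSet ∘ L) v (∈-labelSet⁺ e)

∈-used⁻ : (L : Vec Bool m → Label N) → ∀ {i} → i ∈ₛ used L → ∃ λ v → L v ≡ just i
∈-used⁻ L h = let v , q = ∈-unionᵥ⁻ (labelSet ∘ L) h in v , ∈-labelSet⁻ (L v) q

-- A vertex whose label does not occur in L must face a deleted vertex of L.
∣used─used∣≤faults : (L K : Vec Bool m → Label N) → (∀ v → Compatible (L v) (K v)) →
  ∣ used K ─ used L ∣ ≤ faults L
∣used─used∣≤faults {N = N} L K c = ≤-trans (p⊆q⇒∣p∣≤∣q∣ incl)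
  (≤-trans (∣unionᵥ∣≤sumᵥ facing) (sumᵥ-mono (λ v → bound (L v) (K v))))
  where
  face : Label N → Label N → Subset N
  face nothing  y = labelSet y
  face (just _) y = ⊥

  facing : Vec Bool _ → Subset N
  facing v = face (L v) (K v)

  bound : ∀ x y → ∣ face x y ∣ ≤ deleted x
  bound nothing  y = ∣labelSet∣≤1 y
  bound (just _) y = ≤-reflexive (∣⊥∣≡0 N)

  here-or-used : ∀ {i} v → K v ≡ just i → i ∉ₛ used L → i ∈ₛ facing v
  here-or-used v e i∉ with L v in eq
  ... | nothing = ∈-labelSet⁺ e
  ... | just j  = ⊥-elim (i∉ (∈-used⁺ L (trans eq (cong just (c v eq e)))))

  incl : used K ─ used L ⊆ unionᵥ facing
  incl {i} h with ∈-used⁻ K (p─q⊆p (used K) (used L) h)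
  ... | v , e = ∈-unionᵥ⁺ facing v (here-or-used v e (x∈p─q⇒x∉q (used K) (used L) h))

-- At most one label of K recurs in L; each of the others is charged to a deleted vertex of L.
pred∣used∣≤faults : (L K : Vec Bool m → Label N) → (∀ v → Compatible (L v) (K v)) →
  ∣ used L ∣ ≤ 1 → pred ∣ used K ∣ ≤ faults L
pred∣used∣≤faults L K c single = ≤-trans
  (pred-mono-≤ (≤-trans (∣p∣≤∣p─q∣+∣q∣ (used K) (used L))
    (≤-trans (+-monoʳ-≤ _ single) (≤-reflexive (+-comm _ 1)))))
  (∣used─used∣≤faults L K c)

Proper : (Vec Bool m → Label N) → Set
Proper {m} L = ∀ v i → Compatible (L v) (L (v [ i ]%= not))

-- `pred ∣ p ∣` counts the labels besides a common label x, and in this count the two halves simply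
-- add up.
pred-∣p∪q∣ : (p q : Subset N) {x : Fin N} → x ∈ₛ p → x ∈ₛ q →
  pred ∣ p ∪ q ∣ ≤ pred ∣ p ∣ + pred ∣ q ∣
pred-∣p∪q∣ p q x∈p x∈q = shift (∣p∪q∣<∣p∣+∣q∣ p q x∈p x∈q) (x∈p⇒1≤∣p∣ x∈p) (x∈p⇒1≤∣p∣ x∈q)
  where
  shift : ∀ {a b k} → suc k ≤ a + b → 1 ≤ a → 1 ≤ b → pred k ≤ pred a + pred b
  shift {suc a} {suc b} (s≤s h) _ _ = pred-mono-≤ (≤-trans h (≤-reflexive (+-suc a b)))

∣p∪q∣≤∣q∣ : (p q : Subset N) {x : Fin N} → ∣ p ∣ ≤ 1 → x ∈ₛ p → x ∈ₛ q → ∣ p ∪ q ∣ ≤ ∣ q ∣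
∣p∪q∣≤∣q∣ p q h x∈p x∈q = ≤-pred (≤-trans (∣p∪q∣<∣p∣+∣q∣ p q x∈p x∈q) (+-monoˡ-≤ ∣ q ∣ h))

∣p∪q∣≤∣p∣ : (p q : Subset N) {x : Fin N} → ∣ q ∣ ≤ 1 → x ∈ₛ p → x ∈ₛ q → ∣ p ∪ q ∣ ≤ ∣ p ∣
∣p∪q∣≤∣p∣ p q h x∈p x∈q =
  ≤-trans (≤-reflexive (cong ∣_∣ (∪-comm p q))) (∣p∪q∣≤∣q∣ q p h x∈q x∈p)

-- Induction along the first coordinate, by cases on whether the two halves share a label and on
-- whether one of them carries only that label.
cube-bound : (L : Vec Bool m → Label N) → Proper L → F m (pred ∣ used L ∣) ≤ faults L
cube-bound {zero}  L pr = ≤-trans (F-monoʳ 0 (pred-mono-≤ (∣labelSet∣≤1 (L [])))) z≤n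
cube-bound {suc m} L pr with nonempty? (used (L ∘ (false ∷_)) ∩ used (L ∘ (true ∷_)))
-- Without a common label every edge between the halves has a deleted end, and these `2 ^ m` edges
-- are disjoint.
... | no empty = ≤-trans (F≤2^ m _) (≤-trans (sumᵥ-≥1 pair) (≤-reflexive (sumᵥ-+ (deleted ∘ L ∘ (false ∷_)) _)))
  where
  pair : ∀ v → 1 ≤ deleted (L (false ∷ v)) + deleted (L (true ∷ v))
  pair v with L (false ∷ v) in e₀ | L (true ∷ v) in e₁
  ... | nothing | _       = s≤s z≤n
  ... | just _  | nothing = s≤s z≤n
  ... | just i  | just j  with refl ← pr (false ∷ v) zero e₀ e₁ = contradiction
    (i , x∈p∩q⁺ (∈-used⁺ (L ∘ (false ∷_)) e₀ , ∈-used⁺ (L ∘ (true ∷_)) e₁)) empty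
... | yes (x , x∈∩) = split (<-≤-connex ∣ U₀ ∣ 2) (<-≤-connex ∣ U₁ ∣ 2)
  where
  open ≤-Reasoning
  L₀ = L ∘ (false ∷_)
  L₁ = L ∘ (true ∷_)
  U₀ = used L₀
  U₁ = used L₁
  x∈U₀ = proj₁ (x∈p∩q⁻ U₀ U₁ x∈∩)
  x∈U₁ = proj₂ (x∈p∩q⁻ U₀ U₁ x∈∩)
  IH₀ = cube-bound L₀ (λ v i → pr (false ∷ v) (suc i))
  IH₁ = cube-bound L₁ (λ v i → pr (true ∷ v) (suc i))

  ∪≤U₁ : ∣ U₀ ∣ ≤ 1 → ∣ U₀ ∪ U₁ ∣ ≤ ∣ U₁ ∣
  ∪≤U₁ single = ∣p∪q∣≤∣q∣ U₀ U₁ single x∈U₀ x∈U₁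

  ∪≤U₀ : ∣ U₁ ∣ ≤ 1 → ∣ U₀ ∪ U₁ ∣ ≤ ∣ U₀ ∣
  ∪≤U₀ single = ∣p∪q∣≤∣p∣ U₀ U₁ single x∈U₀ x∈U₁

  split : ∣ U₀ ∣ < 2 ⊎ 2 ≤ ∣ U₀ ∣ → ∣ U₁ ∣ < 2 ⊎ 2 ≤ ∣ U₁ ∣ →
    F (suc m) (pred ∣ U₀ ∪ U₁ ∣) ≤ faults L₀ + faults L₁
  -- Here `U₀` consists of x alone. The labels of `U₁` other than x each face a deleted vertex of
  -- `L₀`, which covers the increment of `F` from m to `suc m`.
  split (inj₁ (s≤s small)) _ = begin
    F (suc m) (pred ∣ U₀ ∪ U₁ ∣)            ≤⟨ F-monoʳ (suc m) (pred-mono-≤ (∪≤U₁ small)) ⟩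
    F (suc m) (pred ∣ U₁ ∣)                 ≤⟨ F-suc-≤ m _ ⟩
    F m (pred ∣ U₁ ∣) + pred ∣ U₁ ∣         ≤⟨ +-mono-≤ IH₁ (pred∣used∣≤faults L₀ L₁ (λ v → pr (false ∷ v) zero) small) ⟩
    faults L₁ + faults L₀                   ≡⟨ +-comm (faults L₁) _ ⟩
    faults L₀ + faults L₁                   ∎
  split (inj₂ _) (inj₁ (s≤s small)) = begin
    F (suc m) (pred ∣ U₀ ∪ U₁ ∣)            ≤⟨ F-monoʳ (suc m) (pred-mono-≤ (∪≤U₀ small)) ⟩
    F (suc m) (pred ∣ U₀ ∣)                 ≤⟨ F-suc-≤ m _ ⟩
    F m (pred ∣ U₀ ∣) + pred ∣ U₀ ∣         ≤⟨ +-mono-≤ IH₀ (pred∣used∣≤faults L₁ L₀ (λ v → pr (true ∷ v) zero) small) ⟩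
    faults L₀ + faults L₁                   ∎
  -- Both halves carry a label besides x, as `F-suc-+-≤` requires.
  split (inj₂ big₀) (inj₂ big₁) = begin
    F (suc m) (pred ∣ U₀ ∪ U₁ ∣)              ≤⟨ F-monoʳ (suc m) (pred-∣p∪q∣ U₀ U₁ x∈U₀ x∈U₁) ⟩
    F (suc m) (pred ∣ U₀ ∣ + pred ∣ U₁ ∣)     ≤⟨ F-suc-+-≤ m (pred-mono-≤ big₀) (pred-mono-≤ big₁) ⟩
    F m (pred ∣ U₀ ∣) + F m (pred ∣ U₁ ∣)     ≤⟨ +-mono-≤ IH₀ IH₁ ⟩
    faults L₀ + faults L₁                     ∎

-- Families of cubes with a common label, and the clusters of the dual cube.

-- The index cube is split in halves. If both halves carry labels besides x, their weak bounds
-- combine into the strong one by `F-suc-+-≤`; otherwise one half contributes only x and the other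
-- decides. The weak bound is carried along because this combination consumes it.
family-bound : ∀ {p} (s : Vec Bool p → ℕ) (U : Vec Bool p → Subset N) {x : Fin N} →
  (∀ v → x ∈ₛ U v) → (∀ v → F m (pred ∣ U v ∣) ≤ s v) →
  F m (pred ∣ unionᵥ U ∣) ≤ sumᵥ s ×
  (F (suc m) (pred ∣ unionᵥ U ∣) ≤ sumᵥ s ⊎
   ∃ λ v → ∣ unionᵥ U ∣ ≤ ∣ U v ∣ × (∀ v′ → v′ ≢ v → ∣ U v′ ∣ ≤ 1))
family-bound {p = zero} s U x∈ h =
  h [] , inj₂ ([] , ≤-refl , λ { [] ne → contradiction refl ne })
family-bound {m = m} {p = suc p} s U {x} x∈ h
  with family-bound (s ∘ (false ∷_)) (U ∘ (false ∷_)) (x∈ ∘ (false ∷_)) (h ∘ (false ∷_))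
     | family-bound (s ∘ (true ∷_)) (U ∘ (true ∷_)) (x∈ ∘ (true ∷_)) (h ∘ (true ∷_))
... | weak₀ , strong₀ | weak₁ , strong₁ =
  weak , split (<-≤-connex ∣ U₀ ∣ 2) (<-≤-connex ∣ U₁ ∣ 2)
  where
  open ≤-Reasoning
  s₀ = sumᵥ (s ∘ (false ∷_))
  s₁ = sumᵥ (s ∘ (true ∷_))
  U₀ = unionᵥ (U ∘ (false ∷_))
  U₁ = unionᵥ (U ∘ (true ∷_))

  x∈U₀ : x ∈ₛ U₀
  x∈U₀ = let v = replicate p false in ∈-unionᵥ⁺ (U ∘ (false ∷_)) v (x∈ (false ∷ v))

  x∈U₁ : x ∈ₛ U₁
  x∈U₁ = let v = replicate p false in ∈-unionᵥ⁺ (U ∘ (true ∷_)) v (x∈ (true ∷ v))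

  pred-union : pred ∣ U₀ ∪ U₁ ∣ ≤ pred ∣ U₀ ∣ + pred ∣ U₁ ∣
  pred-union = pred-∣p∪q∣ U₀ U₁ x∈U₀ x∈U₁

  weak : F m (pred ∣ U₀ ∪ U₁ ∣) ≤ s₀ + s₁
  weak = begin
    F m (pred ∣ U₀ ∪ U₁ ∣)                    ≤⟨ F-monoʳ m pred-union ⟩
    F m (pred ∣ U₀ ∣ + pred ∣ U₁ ∣)           ≤⟨ F-subadditive m (pred ∣ U₀ ∣) _ ⟩
    F m (pred ∣ U₀ ∣) + F m (pred ∣ U₁ ∣)     ≤⟨ +-mono-≤ weak₀ weak₁ ⟩
    s₀ + s₁                                   ∎

  ∣U∣≤∣unionᵥ∣ : ∀ {q} (W : Vec Bool q → Subset _) v → ∣ W v ∣ ≤ ∣ unionᵥ W ∣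
  ∣U∣≤∣unionᵥ∣ W v = p⊆q⇒∣p∣≤∣q∣ (∈-unionᵥ⁺ W v)

  split : ∣ U₀ ∣ < 2 ⊎ 2 ≤ ∣ U₀ ∣ → ∣ U₁ ∣ < 2 ⊎ 2 ≤ ∣ U₁ ∣ →
    F (suc m) (pred ∣ U₀ ∪ U₁ ∣) ≤ s₀ + s₁ ⊎
    ∃ λ v → ∣ U₀ ∪ U₁ ∣ ≤ ∣ U v ∣ × (∀ v′ → v′ ≢ v → ∣ U v′ ∣ ≤ 1)
  split (inj₁ (s≤s small)) _ = Sum.map
    (λ le → ≤-trans (F-monoʳ (suc m) (pred-mono-≤ ∪≤)) (≤-trans le (m≤n+m s₁ s₀)))
    (λ { (v , all , others) → true ∷ v , ≤-trans ∪≤ all , λ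
      { (true ∷ v′) ne → others v′ (ne ∘ cong (true ∷_))
      ; (false ∷ v′) _ → ≤-trans (∣U∣≤∣unionᵥ∣ (U ∘ (false ∷_)) v′) small } })
    strong₁
    where
    ∪≤ : ∣ U₀ ∪ U₁ ∣ ≤ ∣ U₁ ∣
    ∪≤ = ∣p∪q∣≤∣q∣ U₀ U₁ small x∈U₀ x∈U₁
  split (inj₂ _) (inj₁ (s≤s small)) = Sum.map
    (λ le → ≤-trans (F-monoʳ (suc m) (pred-mono-≤ ∪≤)) (≤-trans le (m≤m+n s₀ s₁)))
    (λ { (v , all , others) → false ∷ v , ≤-trans ∪≤ all , λ
      { (false ∷ v′) ne → others v′ (ne ∘ cong (false ∷_))
      ; (true ∷ v′) _ → ≤-trans (∣U∣≤∣unionᵥ∣ (U ∘ (true ∷_)) v′) small } })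
    strong₀
    where
    ∪≤ : ∣ U₀ ∪ U₁ ∣ ≤ ∣ U₀ ∣
    ∪≤ = ∣p∪q∣≤∣p∣ U₀ U₁ small x∈U₀ x∈U₁
  split (inj₂ big₀) (inj₂ big₁) = inj₁ (begin
    F (suc m) (pred ∣ U₀ ∪ U₁ ∣)              ≤⟨ F-monoʳ (suc m) pred-union ⟩
    F (suc m) (pred ∣ U₀ ∣ + pred ∣ U₁ ∣)     ≤⟨ F-suc-+-≤ m (pred-mono-≤ big₀) (pred-mono-≤ big₁) ⟩
    F m (pred ∣ U₀ ∣) + F m (pred ∣ U₁ ∣)     ≤⟨ +-mono-≤ weak₀ weak₁ ⟩
    s₀ + s₁                                   ∎)

-- Λ c w is the cluster of class c whose vertices share the bits w; in D_n, the
-- vertex u of cluster w is matched with the vertex w of cluster u of the other class.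
module Dual (Λ : Bool → Vec Bool m → Vec Bool m → Label N)
  (proper : ∀ c w → Proper (Λ c w))
  (cross : ∀ w u → Compatible (Λ false w u) (Λ true u w)) where

  crossing : ∀ c w u → Compatible (Λ c w u) (Λ (not c) u w)
  crossing false w u = cross w u
  crossing true  w u = Compatible-sym {x = Λ false u w} {Λ true w u} (cross u w)

  -- Putting the class bit in front makes the clusters of both classes one family indexed by a cube,
  -- the form that `family-bound` takes.
  cluster : Vec Bool (suc m) → Vec Bool m → Label N
  cluster (c ∷ w) = Λ c w

  half : Bool → ℕ
  half c = sumᵥ (faults ∘ Λ c)

  total : ℕ
  total = sumᵥ (faults ∘ cluster)

  labels : Subset N
  labels = unionᵥ (used ∘ cluster)

  halves : ∀ c → half c + half (not c) ≡ total
  halves false = refl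
  halves true  = +-comm (half true) (half false)

  faultless⇒just : ∀ {c w} → faults (Λ c w) ≡ 0 → ∀ u → ∃ λ i → Λ c w u ≡ just i
  faultless⇒just {c} {w} e u = alive (Λ c w u) (≤-trans (≤-sumᵥ (deleted ∘ Λ c w) u) (≤-reflexive e))
    where
    alive : ∀ x → deleted x ≤ 0 → ∃ λ i → x ≡ just i
    alive (just i) _ = i , refl

  -- The cube bound doubles as connectivity of an intact cluster: a second label would cost
  -- `F m (suc k)` deletions, a positive number.
  faultless⇒single : ∀ {c w} → faults (Λ c w) ≡ 0 → ∣ used (Λ c w) ∣ ≤ 1
  faultless⇒single {c} {w} e with ∣ used (Λ c w) ∣ | cube-bound (Λ c w) (proper c w)
  ... | zero        | _ = z≤n
  ... | suc zero    | _ = ≤-refl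
  ... | suc (suc k) | h = contradiction (≤-trans h (≤-reflexive e)) λ ()

  faultless⇒≡ : ∀ {c w} → faults (Λ c w) ≡ 0 → ∀ {u v i} → Λ c w u ≡ just i → Λ c w v ≡ just i
  faultless⇒≡ {c} {w} e {u} {v} p with faultless⇒just e v
  ... | j , q = trans q (cong just (∣p∣≤1⇒x≡y (faultless⇒single e) (∈-used⁺ (Λ c w) q) (∈-used⁺ (Λ c w) p)))

  -- Each class has `2 ^ m` clusters and fewer deletions than that, so the pigeonhole principle
  -- applies to each.
  few-faults : total < 2 ^ m → ∀ c → ∃ λ w → faults (Λ c w) ≡ 0
  few-faults few c = sumᵥ-small⇒zero (faults ∘ Λ c)
    (≤-<-trans (≤-trans (m≤m+n (half c) (half (not c))) (≤-reflexive (halves c))) few)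

  module _ (few : total < 2 ^ m) {x : Fin N}
    (main : ∀ c → ∃ λ w → faults (Λ c w) ≡ 0 × (∀ u → Λ c w u ≡ just x)) where

    -- Each vertex of a cluster avoiding x is deleted or matched into a cluster
    -- with a fault, and these clusters are distinct.
    main-everywhere : ∀ c w → x ∈ₛ used (Λ c w)
    main-everywhere c w = decidable-stable (x ∈ₛ? used (Λ c w)) λ x∉ →
      contradiction (begin
        2 ^ m                                                   ≤⟨ sumᵥ-≥1 (blocked x∉) ⟩
        sumᵥ (λ u → deleted (Λ c w u) + faults (Λ (not c) u))   ≡⟨ sumᵥ-+ (deleted ∘ Λ c w) _ ⟩
        faults (Λ c w) + half (not c)                           ≤⟨ +-monoˡ-≤ _ (≤-sumᵥ (faults ∘ Λ c) w) ⟩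
        half c + half (not c)                                   ≡⟨ halves c ⟩
        total                                                   ∎) (<⇒≱ few)
      where
      open ≤-Reasoning
      blocked : x ∉ₛ used (Λ c w) → ∀ u → 1 ≤ deleted (Λ c w u) + faults (Λ (not c) u)
      blocked x∉ u with Λ c w u in eq | faults (Λ (not c) u) in e
      ... | nothing | _     = s≤s z≤n
      ... | just i  | suc _ = s≤s z≤n
      -- Cluster `u` of the other class is intact and meets the main cluster `w₀`, so it carries x
      -- throughout. Its cross edge into `w` then forces x there, against `x∉`.
      ... | just i  | zero  with main c
      ...   | w₀ , _ , all-x with faultless⇒just e w₀
      ...     | j , q with refl ← crossing c w₀ u (all-x u) q =
        contradiction (∈-used⁺ (Λ c w) (trans eq (cong just (crossing c w u eq (faultless⇒≡ e q))))) x∉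

    -- Either `family-bound` already gives the strong bound, or one cluster has all the labels. In
    -- the latter case deletions inside that cluster pay `F m`, and deletions in the opposite class
    -- pay the rest.
    few-faults-bound : F (suc m) (pred ∣ labels ∣) ≤ total
    few-faults-bound with family-bound (faults ∘ cluster) (used ∘ cluster)
      (λ { (c ∷ w) → main-everywhere c w }) (λ { (c ∷ w) → cube-bound (Λ c w) (proper c w) })
    ... | _ , inj₁ le = le
    ... | _ , inj₂ (c ∷ w , all , others) = begin
      F (suc m) (pred ∣ labels ∣)                           ≤⟨ F-monoʳ (suc m) (pred-mono-≤ all) ⟩
      F (suc m) (pred ∣ used (Λ c w) ∣)                     ≤⟨ F-suc-≤ m _ ⟩
      F m (pred ∣ used (Λ c w) ∣) + pred ∣ used (Λ c w) ∣   ≤⟨ +-mono-≤ (cube-bound (Λ c w) (proper c w)) matched ⟩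
      faults (Λ c w) + half (not c)                         ≤⟨ +-monoˡ-≤ _ (≤-sumᵥ (faults ∘ Λ c) w) ⟩
      half c + half (not c)                                 ≡⟨ halves c ⟩
      total                                                 ∎
      where
      open ≤-Reasoning
      -- The partners of the vertices of cluster `w` lie one in each cluster of the opposite class.
      -- All of those clusters carry only x.
      mates : Vec Bool m → Label N
      mates u = Λ (not c) u w

      mates-single : used mates ⊆ ⁅ x ⁆
      mates-single i∈ with ∈-used⁻ mates i∈
      ... | u , e = subst (_∈ₛ ⁅ x ⁆)
        -- The class bits differ, so this cluster is not the exceptional one.
        (∣p∣≤1⇒x≡y (others (not c ∷ u) λ q → not-¬ refl (sym (cong head q)))
          (main-everywhere (not c) u) (∈-used⁺ (Λ (not c) u) e))
        (x∈⁅x⁆ x)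

      matched : pred ∣ used (Λ c w) ∣ ≤ half (not c)
      matched = ≤-trans
        (pred∣used∣≤faults mates (Λ c w)
          (λ u → Compatible-sym {x = Λ c w u} {mates u} (crossing c w u))
          (≤-trans (p⊆q⇒∣p∣≤∣q∣ mates-single) (≤-reflexive (∣⁅x⁆∣≡1 x))))
        (sumᵥ-mono (λ u → ≤-sumᵥ (deleted ∘ Λ (not c) u) w))

  -- With few deletions, the cross edge between an intact cluster of each class has both ends alive,
  -- so the two clusters share one label; it serves as the main label x.
  dual-bound : F (suc m) (pred ∣ labels ∣) ≤ total
  dual-bound with <-≤-connex total (2 ^ m)
  ... | inj₂ many = ≤-trans (F≤2^ m _) many
  ... | inj₁ few with few-faults few false | few-faults few true
  ...   | w₀ , e₀ | w₁ , e₁ with faultless⇒just e₀ w₁ | faultless⇒just e₁ w₀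
  ...     | x , p | y , q with refl ← cross w₀ w₁ p q = few-faults-bound few λ
    { false → w₀ , e₀ , λ u → faultless⇒≡ e₀ p
    ; true  → w₁ , e₁ , λ u → faultless⇒≡ e₁ q }

-- Block coordinates of the dual cube and its adjacency.

-- The bit `c` is the class. In class `false` the block `a` varies within a cluster named by `b`; in
-- class `true` the roles are exchanged. The block lengths are separate because `Vertex (suc M)` has
-- length `M + suc (M + 0)`.
vertex : Vec Bool A → Vec Bool B → Bool → Vec Bool (A + suc B)
vertex a b c = a ++ (b ∷ʳ c)

data VertexView {A B} : Vec Bool (A + suc B) → Set where
  vtx : ∀ a b c → VertexView {A} {B} (vertex a b c)

vertexView : ∀ A {B} (v : Vec Bool (A + suc B)) → VertexView {A} {B} v
vertexView A v with splitAt A v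
... | a , w , refl with initLast w
...   | b , c , refl = vtx a b c

lastPos : ∀ A B → Fin (A + suc B)
lastPos A B = A ↑ʳ fromℕ B

lookup-last : (a : Vec Bool A) (b : Vec Bool B) (c : Bool) → lookup (vertex a b c) (lastPos A B) ≡ c
lookup-last []      []      c = refl
lookup-last []      (_ ∷ b) c = lookup-last [] b c
lookup-last (_ ∷ a) b       c = lookup-last a b c

flip-left : (a : Vec Bool A) (b : Vec Bool B) (c : Bool) (i : Fin A) →
  vertex a b c [ i ↑ˡ suc B ]%= not ≡ vertex (a [ i ]%= not) b c
flip-left (x ∷ a) b c zero    = refl
flip-left (x ∷ a) b c (suc i) = cong (x ∷_) (flip-left a b c i)

flip-right : (a : Vec Bool A) (b : Vec Bool B) (c : Bool) (i : Fin B) →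
  vertex a b c [ A ↑ʳ inject₁ i ]%= not ≡ vertex a (b [ i ]%= not) c
flip-right []      (x ∷ b) c zero    = refl
flip-right []      (x ∷ b) c (suc i) = cong (x ∷_) (flip-right [] b c i)
flip-right (x ∷ a) b       c i       = cong (x ∷_) (flip-right a b c i)

flip-last : (a : Vec Bool A) (b : Vec Bool B) (c : Bool) →
  vertex a b c [ lastPos A B ]%= not ≡ vertex a b (not c)
flip-last []      []      c = refl
flip-last []      (x ∷ b) c = cong (x ∷_) (flip-last [] b c)
flip-last (x ∷ a) b       c = cong (x ∷_) (flip-last a b c)

data PositionView (A B : ℕ) : Fin (A + suc B) → Set where
  left  : ∀ i → PositionView A B (i ↑ˡ suc B)
  right : ∀ i → PositionView A B (A ↑ʳ inject₁ i)
  end   : PositionView A B (lastPos A B)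

positionView : ∀ A B i → PositionView A B i
positionView A B i with Fin.splitAt A i in eq
... | inj₁ j = subst (PositionView A B) (splitAt⁻¹-↑ˡ eq) (left j)
... | inj₂ j with view j
...   | ‵fromℕ     = subst (PositionView A B) (splitAt⁻¹-↑ʳ {m = A} eq) end
...   | ‵inject₁ k = subst (PositionView A B) (splitAt⁻¹-↑ʳ {m = A} eq) (right k)

toℕ-left : ∀ {A B} (i : Fin A) → toℕ (i ↑ˡ suc B) ≡ toℕ i
toℕ-left {B = B} i = toℕ-↑ˡ i (suc B)

toℕ-right : ∀ A {B} (i : Fin B) → toℕ (A ↑ʳ inject₁ i) ≡ A + toℕ i
toℕ-right A i = trans (toℕ-↑ʳ A (inject₁ i)) (cong (A +_) (toℕ-inject₁ i))

toℕ-lastPos : ∀ A B → toℕ (lastPos A B) ≡ A + B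
toℕ-lastPos A B = trans (toℕ-↑ʳ A (fromℕ B)) (cong (A +_) (toℕ-fromℕ B))

module _ {M : ℕ} where

  last-index : 2 * suc M ∸ 2 ≡ M + (M + 0)
  last-index = cong pred (+-suc M (M + 0))

  lastBit : (a : Vec Bool M) (b : Vec Bool (M + 0)) (c : Bool) → LastBit (suc M) (vertex a b c) c
  lastBit a b c j e = trans (cong (lookup (vertex a b c))
    (toℕ-injective (trans e (trans last-index (sym (toℕ-lastPos M (M + 0))))))) (lookup-last a b c)

  LastBit-injective : ∀ {v b c} → LastBit (suc M) v b → LastBit (suc M) v c → b ≡ c
  LastBit-injective h k = trans (sym (h _ e)) (k _ e)
    where
    e : toℕ (lastPos M (M + 0)) ≡ 2 * suc M ∸ 2
    e = trans (toℕ-lastPos M (M + 0)) (sym last-index)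

  flip-differs : (v : Vertex (suc M)) → ∀ i → DifferExactlyAt (suc M) v (v [ i ]%= not) i
  flip-differs v i = (λ e → not-¬ refl (trans e (lookup∘updateAt i v))) ,
    λ j ne → sym (lookup∘updateAt′ j i ne v)

  differs⇒flip : ∀ {u v i} → DifferExactlyAt (suc M) u v i → v ≡ u [ i ]%= not
  differs⇒flip {u} {v} {i} (ne , same) = lookup-ext λ j → at j (j Fin.≟ i)
    where
    at : ∀ j → Dec (j ≡ i) → lookup v j ≡ lookup (u [ i ]%= not) j
    at j (yes refl) = trans (sym (not-involutive _)) (trans (cong not (sym (¬-not ne))) (sym (lookup∘updateAt i u)))
    at j (no j≢i)   = trans (sym (same j j≢i)) (sym (lookup∘updateAt′ j i j≢i u))
    lookup-ext : {v w : Vertex (suc M)} → (∀ j → lookup v j ≡ lookup w j) → v ≡ w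
    lookup-ext {v} {w} h = trans (sym (tabulate∘lookup v)) (trans (tabulate-cong h) (tabulate∘lookup w))

  Adj-left : ∀ a b i → Adj (suc M) (vertex a b false) (vertex (a [ i ]%= not) b false)
  Adj-left a b i = i ↑ˡ _ ,
    subst (λ v → DifferExactlyAt (suc M) (vertex a b false) v _)
      (flip-left a b false i) (flip-differs (vertex a b false) _) ,
    inj₁ (subst (_< M) (sym (toℕ-left i)) (toℕ<n i) , lastBit a b false , lastBit (a [ i ]%= not) b false)

  Adj-right : ∀ a b i → Adj (suc M) (vertex a b true) (vertex a (b [ i ]%= not) true)
  Adj-right a b i = M ↑ʳ inject₁ i ,
    subst (λ v → DifferExactlyAt (suc M) (vertex a b true) v _)
      (flip-right a b true i) (flip-differs (vertex a b true) _) ,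
    inj₂ (inj₁ ((s≤s (≤-trans (m≤m+n M (toℕ i)) (≤-reflexive (sym (toℕ-right M i)))) ,
      subst₂ _<_ (sym (toℕ-right M i)) (sym last-index) (+-monoʳ-< M (toℕ<n i))) ,
      lastBit a b true , lastBit a (b [ i ]%= not) true))

  Adj-last : ∀ a b → Adj (suc M) (vertex a b false) (vertex a b true)
  Adj-last a b = lastPos M (M + 0) ,
    subst (λ v → DifferExactlyAt (suc M) (vertex a b false) v _)
      (flip-last a b false) (flip-differs (vertex a b false) _) ,
    inj₂ (inj₂ (trans (cong suc (toℕ-lastPos M (M + 0))) (sym (+-suc M (M + 0)))))

  -- Class `false` is where the vertices isolated by the extremal cut lie.
  neighbour : ∀ a b {v} → Adj (suc M) (vertex a b false) v →
    (∃ λ i → v ≡ vertex (a [ i ]%= not) b false) ⊎ v ≡ vertex a b true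
  neighbour a b {v} (i , d , kind) with differs⇒flip {vertex a b false} {v} d | positionView M (M + 0) i
  ... | e | left j  = inj₁ (j , trans e (flip-left a b false j))
  ... | e | end     = inj₂ (trans e (flip-last a b false))
  -- A flip in the second block is too far right for the first adjacency rule, has the wrong class
  -- bit for the second, and is not at the final position for the third.
  ... | e | right j = contradiction kind impossible
    where
    impossible : ¬ _
    impossible (inj₁ (h , _)) =
      contradiction (≤-trans h (≤-trans (m≤m+n M (toℕ j)) (≤-reflexive (sym (toℕ-right M j))))) 1+n≰n
    impossible (inj₂ (inj₁ (_ , last , _))) =
      contradiction (LastBit-injective {vertex a b false} last (lastBit a b false)) λ ()
    impossible (inj₂ (inj₂ h)) = contradiction
      (suc-injective (trans h (+-suc M (M + 0))))
      (<⇒≢ (subst (_< M + (M + 0)) (sym (toℕ-right M j)) (+-monoʳ-< M (toℕ<n j))))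

-- Reachability, and counting the vertices of a list.

Adj-sym : ∀ {n u v} → Adj n u v → Adj n v u
Adj-sym (i , (ne , same) , kind) = i , (ne ∘ sym , λ j h → sym (same j h)) , Sum.map
  (λ { (h , k , l) → h , l , k }) (Sum.map (λ { (h , k , l) → h , l , k }) (λ h → h)) kind

Reach-∉ : ∀ {n S u v} → Reach n S u v → v ∉ S
Reach-∉ (here h)     = h
Reach-∉ (step _ _ h) = h

Reach-trans : ∀ {n S u v w} → Reach n S u v → Reach n S v w → Reach n S u w
Reach-trans p (here _)     = p
Reach-trans p (step q e h) = step (Reach-trans p q) e h

Reach-sym : ∀ {n S u v} → Reach n S u v → Reach n S v u
Reach-sym (here h)             = here h
Reach-sym {n} (step {w} {v} p e h) = Reach-trans (step (here h) (Adj-sym {n} {w} {v} e) (Reach-∉ p)) (Reach-sym p)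

_∈?_ : (v : Vec Bool m) (S : List (Vec Bool m)) → Dec (v ∈ S)
_∈?_ = DecMembership._∈?_ (≡-dec Bool._≟_)

indicator : {P : Set} → Dec P → ℕ
indicator (yes _) = 1
indicator (no _)  = 0

indicator-mono : {P Q : Set} (p : Dec P) (q : Dec Q) → (P → Q) → indicator p ≤ indicator q
indicator-mono (no _)  _       f = z≤n
indicator-mono (yes p) (yes _) f = ≤-refl
indicator-mono (yes p) (no ¬q) f = contradiction (f p) ¬q

indicator-⊎ : {P Q R : Set} (p : Dec P) (q : Dec Q) (r : Dec R) → (P → Q ⊎ R) →
  indicator p ≤ indicator q + indicator r
indicator-⊎ (no _)  _       _       f = z≤n
indicator-⊎ (yes _) (yes _) _       f = s≤s z≤n
indicator-⊎ (yes _) (no _)  (yes _) f = ≤-refl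
indicator-⊎ (yes p) (no ¬q) (no ¬r) f = contradiction (f p) [ ¬q , ¬r ]′

_≟ᵥ_ : (u v : Vec Bool m) → Dec (u ≡ v)
_≟ᵥ_ = ≡-dec Bool._≟_

sumᵥ-zero : {f : Vec Bool m → ℕ} → (∀ v → f v ≡ 0) → sumᵥ f ≡ 0
sumᵥ-zero {zero}  h = h []
sumᵥ-zero {suc m} h = cong₂ _+_ (sumᵥ-zero (h ∘ (false ∷_))) (sumᵥ-zero (h ∘ (true ∷_)))

indicator-no : {P : Set} (p : Dec P) → ¬ P → indicator p ≡ 0
indicator-no (yes p) ¬p = contradiction p ¬p
indicator-no (no _)  _  = refl

∷-tail : ∀ {x y} {u v : Vec Bool m} → x ∷ u ≡ y ∷ v → u ≡ v
∷-tail refl = refl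

sumᵥ-≟ : (s : Vec Bool m) → sumᵥ (λ v → indicator (v ≟ᵥ s)) ≤ 1
sumᵥ-≟ [] = ≤-refl
sumᵥ-≟ (false ∷ s) = +-mono-≤
  (≤-trans (sumᵥ-mono (λ v → indicator-mono ((false ∷ v) ≟ᵥ (false ∷ s)) (v ≟ᵥ s) ∷-tail)) (sumᵥ-≟ s))
  (≤-reflexive (sumᵥ-zero (λ v → indicator-no ((true ∷ v) ≟ᵥ (false ∷ s)) λ ())))
sumᵥ-≟ (true ∷ s) = +-mono-≤
  (≤-reflexive (sumᵥ-zero (λ v → indicator-no ((false ∷ v) ≟ᵥ (true ∷ s)) λ ())))
  (≤-trans (sumᵥ-mono (λ v → indicator-mono ((true ∷ v) ≟ᵥ (true ∷ s)) (v ≟ᵥ s) ∷-tail)) (sumᵥ-≟ s))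

-- Converts the faults of a labelling, counted over all vertices, into the length of the deleted
-- list.
sumᵥ-∈≤length : (S : List (Vec Bool m)) → sumᵥ (λ v → indicator (v ∈? S)) ≤ length S
sumᵥ-∈≤length {m} [] = ≤-reflexive (sumᵥ-zero {m} (λ v → indicator-no (v ∈? []) λ ()))
sumᵥ-∈≤length (s ∷ S) = begin
  sumᵥ (λ v → indicator (v ∈? (s ∷ S)))                             ≤⟨ sumᵥ-mono split ⟩
  sumᵥ (λ v → indicator (v ≟ᵥ s) + indicator (v ∈? S))              ≡⟨ sumᵥ-+ (λ v → indicator (v ≟ᵥ s)) _ ⟩
  sumᵥ (λ v → indicator (v ≟ᵥ s)) + sumᵥ (λ v → indicator (v ∈? S)) ≤⟨ +-mono-≤ (sumᵥ-≟ s) (sumᵥ-∈≤length S) ⟩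
  suc (length S)                                                    ∎
  where
  open ≤-Reasoning
  split : ∀ v → indicator (v ∈? (s ∷ S)) ≤ indicator (v ≟ᵥ s) + indicator (v ∈? S)
  split v = indicator-⊎ (v ∈? (s ∷ S)) (v ≟ᵥ s) (v ∈? S) λ { (here e) → inj₁ e ; (there h) → inj₂ h }

-- Double negation commutes with a quantifier over finitely many vertices. Reachability can thus be
-- treated as decided everywhere at once when the goal is stable.
¬¬-∀ᵥ : {P : Vec Bool m → Set} → (∀ v → ¬ ¬ P v) → ¬ ¬ (∀ v → P v)
¬¬-∀ᵥ {zero}  h k = h [] λ p → k λ { [] → p }
¬¬-∀ᵥ {suc m} h k = ¬¬-∀ᵥ (h ∘ (false ∷_)) λ p → ¬¬-∀ᵥ (h ∘ (true ∷_)) λ q →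
  k λ { (false ∷ v) → p v ; (true ∷ v) → q v }

-- Transfer of the lower bound to component cuts.

sumᵥ-++ : ∀ A (f : Vec Bool (A + n) → ℕ) → sumᵥ f ≡ sumᵥ {A} (λ a → sumᵥ (λ w → f (a ++ w)))
sumᵥ-++ zero    f = refl
sumᵥ-++ (suc A) f = cong₂ _+_ (sumᵥ-++ A (f ∘ (false ∷_))) (sumᵥ-++ A (f ∘ (true ∷_)))

sumᵥ-∷ʳ : (f : Vec Bool (suc n) → ℕ) → sumᵥ f ≡ sumᵥ (λ b → f (b ∷ʳ false)) + sumᵥ (λ b → f (b ∷ʳ true))
sumᵥ-∷ʳ {zero}  f = refl
sumᵥ-∷ʳ {suc n} f = trans
  (cong₂ _+_ (sumᵥ-∷ʳ (f ∘ (false ∷_))) (sumᵥ-∷ʳ (f ∘ (true ∷_))))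
  (interchange +-commutativeSemigroup (sumᵥ (λ b → f (false ∷ (b ∷ʳ false)))) _ _ _)

-- Regroups the strings into clusters and applies `dual-bound`. The equation is an argument because
-- the lengths `M` and `M + 0` agree only propositionally.
dual-cube-bound : A ≡ B → (L : Vec Bool (A + suc B) → Label N) →
  (∀ (a : Vec Bool A) (b : Vec Bool B) i → Compatible (L (vertex a b false)) (L (vertex (a [ i ]%= not) b false))) →
  (∀ (a : Vec Bool A) (b : Vec Bool B) i → Compatible (L (vertex a b true)) (L (vertex a (b [ i ]%= not) true))) →
  (∀ (a : Vec Bool A) (b : Vec Bool B) → Compatible (L (vertex a b false)) (L (vertex a b true))) →
  F (suc A) (pred ∣ used L ∣) ≤ faults L
dual-cube-bound {A = A} {N = N} refl L l r c = ≤-trans (F-monoʳ (suc A) (pred-mono-≤ (p⊆q⇒∣p∣≤∣q∣ incl)))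
  (≤-trans D.dual-bound (≤-reflexive (sym faults≡total)))
  where
  Λ : Bool → Vec Bool A → Vec Bool A → Label N
  Λ false b a = L (vertex a b false)
  Λ true  a b = L (vertex a b true)

  proper : ∀ c w → Proper (Λ c w)
  proper false b a i = l a b i
  proper true  a b i = r a b i

  cross : ∀ b a → Compatible (Λ false b a) (Λ true a b)
  cross b a = c a b

  module D = Dual Λ proper cross

  incl : used L ⊆ D.labels
  incl i∈ with ∈-used⁻ L i∈
  ... | v , e with vertexView A v
  ...   | vtx a b false = ∈-unionᵥ⁺ (used ∘ D.cluster) (false ∷ b) (∈-used⁺ (Λ false b) e)
  ...   | vtx a b true  = ∈-unionᵥ⁺ (used ∘ D.cluster) (true ∷ a) (∈-used⁺ (Λ true a) e)

  d : Vec Bool A → Vec Bool A → Bool → ℕ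
  d a b c = deleted (L (vertex a b c))

  faults≡total : faults L ≡ D.total
  faults≡total = begin
    faults L
      ≡⟨ sumᵥ-++ A (deleted ∘ L) ⟩
    sumᵥ {A} (λ a → sumᵥ {suc A} (λ w → deleted (L (a ++ w))))
      ≡⟨ sumᵥ-cong {A} (λ a → sumᵥ-∷ʳ {A} (λ w → deleted (L (a ++ w)))) ⟩
    sumᵥ (λ a → sumᵥ (λ b → d a b false) + sumᵥ (λ b → d a b true))
      ≡⟨ sumᵥ-+ (λ a → sumᵥ (λ b → d a b false)) _ ⟩
    sumᵥ (λ a → sumᵥ (λ b → d a b false)) + D.half true
      -- Clusters of class `false` are named by `b`, so there the order of summation is exchanged.
      ≡⟨ cong (_+ D.half true) (sumᵥ-swap (λ a b → d a b false)) ⟩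
    D.half false + D.half true ∎
    where open ≡-Reasoning

module _ {M k : ℕ} {S : List (Vertex (suc M))}
  (rep : Fin k → Vertex (suc M)) (rep∉S : ∀ i → rep i ∉ S)
  (apart : ∀ i j → i ≢ j → ¬ Reach (suc M) S (rep i) (rep j)) where

  component-unique : ∀ {i j v} → Reach (suc M) S (rep i) v → Reach (suc M) S (rep j) v → i ≡ j
  component-unique {i} {j} p q = decidable-stable (i Fin.≟ j) λ ne → apart i j ne (Reach-trans p (Reach-sym q))

  -- Labelling each surviving vertex by the representative that reaches it uses all k labels and is
  -- constant along surviving edges.
  F≤length-cut : Fin k → (∀ v → Dec (∃ λ i → Reach (suc M) S (rep i) v)) → F (suc M) (pred k) ≤ length S
  F≤length-cut default reach? = begin
    F (suc M) (pred k)                 ≤⟨ F-monoʳ (suc M) (pred-mono-≤ k≤∣used∣) ⟩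
    F (suc M) (pred ∣ used L ∣)        ≤⟨ dual-cube-bound (sym (+-identityʳ M)) L
                                            (λ a b i → compatible (Adj-left a b i))
                                            (λ a b i → compatible (Adj-right a b i))
                                            (λ a b → compatible (Adj-last a b)) ⟩
    faults L                           ≤⟨ sumᵥ-mono deleted≤ ⟩
    sumᵥ (λ v → indicator (v ∈? S))    ≤⟨ sumᵥ-∈≤length S ⟩
    length S                           ∎
    where
    open ≤-Reasoning
    component : ∀ {v} → Dec (∃ λ i → Reach (suc M) S (rep i) v) → Fin k
    component (yes (i , _)) = i
    -- Components without a representative are all merged under one label. This is harmless: a
    -- surviving neighbour of an unreached vertex is unreached too.
    component (no _)        = default

    label : ∀ {v} → Dec (v ∈ S) → Fin k → Label k
    label (yes _) _ = nothing
    label (no _)  i = just i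

    L : Vertex (suc M) → Label k
    L v = label (v ∈? S) (component (reach? v))

    deleted≤ : ∀ v → deleted (L v) ≤ indicator (v ∈? S)
    deleted≤ v with v ∈? S
    ... | yes _ = ≤-refl
    ... | no _  = z≤n

    component-adj : ∀ {u v} → u ∉ S → v ∉ S → Adj (suc M) u v → ∀ p q → component {u} p ≡ component {v} q
    component-adj u∉ v∉ e (yes (i , p)) (yes (j , q)) = component-unique (step p e v∉) q
    component-adj u∉ v∉ e (yes (i , p)) (no ¬q)       = contradiction (i , step p e v∉) ¬q
    component-adj {u} {v} u∉ v∉ e (no ¬p) (yes (j , q)) =
      contradiction (j , step q (Adj-sym {suc M} {u} {v} e) u∉) ¬p
    component-adj u∉ v∉ e (no _)        (no _)        = refl

    compatible : ∀ {u v} → Adj (suc M) u v → Compatible (L u) (L v)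
    compatible {u} {v} e p q with u ∈? S | v ∈? S
    compatible {u} {v} e refl refl | no u∉ | no v∉ = component-adj u∉ v∉ e (reach? u) (reach? v)

    L-rep : ∀ i → L (rep i) ≡ just i
    L-rep i with rep i ∈? S | reach? (rep i)
    ... | yes h | _             = contradiction h (rep∉S i)
    ... | no h  | yes (j , p)   = cong just (component-unique p (here h))
    ... | no h  | no ¬p         = contradiction (i , here h) ¬p

    all-used : ⊤ ⊆ used L
    all-used {i} _ = ∈-used⁺ L (L-rep i)

    k≤∣used∣ : k ≤ ∣ used L ∣
    k≤∣used∣ = ≤-trans (≤-reflexive (sym (∣⊤∣≡n k))) (p⊆q⇒∣p∣≤∣q∣ all-used)

-- The inequality is decidable, hence stable, so it may be proved under the assumption that
-- reachability is decided.
cut-bound : ∀ {M r S} → AtLeastComponents (suc M) S (suc r) → F (suc M) r ≤ length S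
cut-bound {M} {r} {S} (rep , rep∉S , apart) = decidable-stable (_ ≤? _) λ ¬le →
  ¬¬-∀ᵥ (λ _ → ¬¬-excluded-middle) λ reach? → ¬le (F≤length-cut rep rep∉S apart zero reach?)

-- The extremal cut and the theorem.

zeros : ∀ m → Vec Bool m
zeros m = replicate m false

unit : Fin m → Vec Bool m
unit i = zeros _ [ i ]%= not

units : ∀ m → List (Vec Bool m)
units m = tabulate unit

unit-injective : {i j : Fin m} → unit i ≡ unit j → i ≡ j
unit-injective {i = zero}  {zero}  _ = refl
unit-injective {i = suc i} {suc j} e = cong suc (unit-injective (∷-tail e))

unit≢zeros : (i : Fin m) → unit i ≢ zeros m
unit≢zeros (suc i) e = unit≢zeros i (∷-tail e)

-- The strings of weight two with a one among the first r bits.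
ring : ∀ m → ℕ → List (Vec Bool m)
ring m       zero    = []
ring zero    (suc r) = []
ring (suc m) (suc r) = map (true ∷_) (units m) ++ₗ map (false ∷_) (ring m r)

-- Sorting the strings by the position of their first one gives m - 1, m - 2, and so on, which is
-- the recursion of `G`.
length-ring : ∀ m r → length (ring m r) ≡ G m r
length-ring m       zero    = refl
length-ring zero    (suc r) = refl
length-ring (suc m) (suc r) = begin
  length (map (true ∷_) (units m) ++ₗ map (false ∷_) (ring m r))   ≡⟨ length-++ (map (true ∷_) (units m)) ⟩
  length (map (true ∷_) (units m)) + length (map (false ∷_) (ring m r))
    ≡⟨ cong₂ _+_ (trans (length-map (true ∷_) (units m)) (length-tabulate {n = m} unit))
                 (trans (length-map (false ∷_) (ring m r)) (length-ring m r)) ⟩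
  m + G m r                                                        ∎
  where open ≡-Reasoning

∈-ring⁻ : ∀ {m r} {b} {a : Vec Bool m} → b ∷ a ∈ ring (suc m) (suc r) →
  (b ≡ true × ∃ λ i → a ≡ unit i) ⊎ (b ≡ false × a ∈ ring m r)
∈-ring⁻ {m} {r} h with ∈-++⁻ (map (true ∷_) (units m)) h
... | inj₁ h₁ with ∈-map⁻ (true ∷_) h₁
...   | _ , k , refl = inj₁ (refl , ∈-tabulate⁻ k)
∈-ring⁻ {m} {r} h | inj₂ h₂ with ∈-map⁻ (false ∷_) h₂
...   | _ , k , refl = inj₂ (refl , k)

ring-unique : ∀ m r → Unique (ring m r)
ring-unique m       zero    = []
ring-unique zero    (suc r) = []
ring-unique (suc m) (suc r) = ++⁺ (map⁺ ∷-tail (tabulate⁺ unit-injective)) (map⁺ ∷-tail (ring-unique m r)) disjoint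
  where
  disjoint : Disjoint (map (true ∷_) (units m)) (map (false ∷_) (ring m r))
  disjoint (h , k) with ∈-map⁻ (true ∷_) h | ∈-map⁻ (false ∷_) k
  ... | _ , _ , refl | _ , _ , ()

zeros∉ring : ∀ m r → zeros m ∉ ring m r
zeros∉ring (suc m) (suc r) h with ∈-ring⁻ {m} {r} h
... | inj₂ (_ , k) = zeros∉ring m r k

unit∉ring : ∀ {m} r (i : Fin m) → unit i ∉ ring m r
unit∉ring {suc m} (suc r) zero    h with ∈-ring⁻ {m} {r} h
... | inj₁ (_ , i , e) = unit≢zeros i (sym e)
unit∉ring {suc m} (suc r) (suc i) h with ∈-ring⁻ {m} {r} h
... | inj₂ (_ , k) = unit∉ring r i k

-- A flip either erases the only one or adds a second; in the latter case the one at i < r puts the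
-- string in the ring.
unit-neighbour : ∀ {r} (i j : Fin m) → toℕ i < r → unit i [ j ]%= not ∈ zeros m ∷ ring m r
unit-neighbour zero zero (s≤s _) = here refl
unit-neighbour {suc m} zero (suc j) (s≤s _) =
  there (∈-++⁺ˡ (∈-map⁺ (true ∷_) (∈-tabulate⁺ j)))
unit-neighbour {suc m} (suc i) zero (s≤s _) =
  there (∈-++⁺ˡ (∈-map⁺ (true ∷_) (∈-tabulate⁺ i)))
unit-neighbour {suc m} (suc i) (suc j) (s≤s l) with unit-neighbour i j l
... | here e  = here (cong (false ∷_) e)
... | there h = there (∈-++⁺ʳ (map (true ∷_) (units m)) (∈-map⁺ (false ∷_) h))

vertex-injective : ∀ {a a′ : Vec Bool A} {b b′ : Vec Bool B} {c c′} →
  vertex a b c ≡ vertex a′ b′ c′ → a ≡ a′ × c ≡ c′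
vertex-injective {a = a} {a′} {b} {b′} e with ++-injective a a′ e
... | p , q = p , proj₂ (∷ʳ-injective b b′ q)

-- By induction a path is still at u before its last step, and that step would enter S.
isolated⇒≡ : ∀ {n S u v} → (∀ w → Adj n u w → w ∈ S) → Reach n S u v → v ≡ u
isolated⇒≡ iso (here _) = refl
isolated⇒≡ iso (step p e h) with refl ← isolated⇒≡ iso p = contradiction (iso _ e) h

module StarCut {M r : ℕ} (r≤M : r ≤ M) where

  base : Vec Bool M → Bool → Vertex (suc M)
  base a c = vertex a (zeros (M + 0)) c

  base-injective : ∀ {a a′ c c′} → base a c ≡ base a′ c′ → a ≡ a′ × c ≡ c′
  base-injective = vertex-injective {b = zeros (M + 0)}

  leaf : Fin r → Vec Bool M
  leaf i = unit (inject≤ i r≤M)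

  leaf-injective : ∀ {i j} → leaf i ≡ leaf j → i ≡ j
  leaf-injective e = inject≤-injective r≤M r≤M _ _ (unit-injective e)

  -- `inner` consists of the neighbours of the r leaves within their cluster, namely the centre and
  -- the strings at distance two from it adjacent to a leaf; `outer` consists of the partners of the
  -- leaves in the other class.
  inner outer cut : List (Vertex (suc M))
  inner = map (λ a → base a false) (zeros M ∷ ring M r)
  outer = tabulate (λ i → base (leaf i) true)
  cut   = inner ++ₗ outer

  ∈-inner⁻ : ∀ {a c} → base a c ∈ inner → c ≡ false × a ∈ zeros M ∷ ring M r
  ∈-inner⁻ h with ∈-map⁻ (λ a → base a false) h
  ... | _ , k , e with refl , refl ← base-injective e = refl , k

  ∈-outer⁻ : ∀ {a c} → base a c ∈ outer → c ≡ true × ∃ λ i → a ≡ leaf i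
  ∈-outer⁻ h with ∈-tabulate⁻ h
  ... | i , e with refl , refl ← base-injective e = refl , i , refl

  length-cut : length cut ≡ suc (G (suc M) r)
  length-cut = begin
    length cut                        ≡⟨ length-++ inner ⟩
    length inner + length outer       ≡⟨ cong₂ _+_ (length-map _ (zeros M ∷ ring M r)) (length-tabulate _) ⟩
    suc (length (ring M r)) + r       ≡⟨ cong (λ l → suc l + r) (length-ring M r) ⟩
    -- The r outer vertices are exactly the step from `G M r` to `G (suc M) r`.
    suc (G M r + r)                   ≡⟨ cong suc (G-suc-exact r≤M) ⟨
    suc (G (suc M) r)                 ∎
    where open ≡-Reasoning

  cut-unique : Unique cut
  cut-unique = ++⁺
    (map⁺ (proj₁ ∘ base-injective) (¬Any⇒All¬ _ (zeros∉ring M r) ∷ ring-unique M r))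
    (tabulate⁺ (leaf-injective ∘ proj₁ ∘ base-injective))
    disjoint
    where
    disjoint : Disjoint inner outer
    disjoint (h , k) with ∈-tabulate⁻ k
    ... | i , refl with () ← proj₁ (∈-inner⁻ h)

  -- The leaves end up isolated, so any other survivor can represent one further component; the
  -- partner of the centre is such a survivor.
  rep : Fin (suc r) → Vertex (suc M)
  rep zero    = base (zeros M) true
  rep (suc i) = base (leaf i) false

  rep-injective : ∀ {i j} → rep i ≡ rep j → i ≡ j
  rep-injective {zero}  {zero}  _ = refl
  rep-injective {zero}  {suc j} e with () ← proj₂ (base-injective e)
  rep-injective {suc i} {zero}  e with () ← proj₂ (base-injective e)
  rep-injective {suc i} {suc j} e = cong suc (leaf-injective (proj₁ (base-injective e)))

  rep∉cut : ∀ i → rep i ∉ cut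
  rep∉cut zero h with ∈-++⁻ inner h
  ... | inj₁ k with () ← proj₁ (∈-inner⁻ k)
  ... | inj₂ k with _ , i , e ← ∈-outer⁻ k = unit≢zeros _ (sym e)
  rep∉cut (suc i) h with ∈-++⁻ inner h
  ... | inj₂ k with () ← proj₁ (∈-outer⁻ k)
  ... | inj₁ k with ∈-inner⁻ k
  ...   | _ , here e  = unit≢zeros _ e
  ...   | _ , there l = unit∉ring r _ l

  rep-isolated : ∀ i v → Adj (suc M) (rep (suc i)) v → v ∈ cut
  rep-isolated i v e with neighbour (leaf i) (zeros (M + 0)) {v} e
  ... | inj₁ (j , refl) = ∈-++⁺ˡ (∈-map⁺ (λ a → base a false)
    (unit-neighbour (inject≤ i r≤M) j (subst (_< r) (sym (toℕ-inject≤ i r≤M)) (toℕ<n i))))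
  ... | inj₂ refl = ∈-++⁺ʳ inner (∈-tabulate⁺ i)

  apart : ∀ i j → i ≢ j → ¬ Reach (suc M) cut (rep i) (rep j)
  apart zero    zero    ne _ = contradiction refl ne
  apart (suc i) j       ne p = ne (sym (rep-injective (isolated⇒≡ (rep-isolated i) p)))
  apart zero    (suc j) ne p = ne (rep-injective (isolated⇒≡ (rep-isolated j) (Reach-sym p)))

  is-cut : IsComponentCut (suc M) (suc r) cut
  is-cut = cut-unique , rep , rep∉cut , apart

theorem15 : ∀ (n r : ℕ) → 2 ≤ n → 1 ≤ r → r ≤ n ∸ 1 →
    ComponentConnectivity n (suc r) (r * n ∸ (r * (r + 1)) / 2 + 1)
theorem15 (suc M) (suc r) _ _ r<M =
  (cut , is-cut , trans length-cut (sym formula)) ,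
  -- With r matched as a successor, `F` unfolds to the `suc (G ...)` of the closed form, so
  -- `cut-bound` fits directly.
  λ S (_ , components) → ≤-trans (≤-reflexive formula) (cut-bound components)
  where
  open StarCut r<M
  formula = closed-form (m≤n⇒m≤1+n r<M)
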